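{- Let $R$ be a Kock--Lawvere ring that is a $\mathbb{Q}$-algebra. Let $k\in\mathbb{N}$, let $d_0,\dots,d_{k-1} \in D$ and $\delta=d_0+\dots+d_{k-1}$. For any function $f\colon R \to R$ and for all $x \in R$ we have \[ f(x+\delta)= \sum_{n < k + 1} \partial^n f(x)\, \frac{\delta^n}{n!} =f(x)+\partial f(x)\, \delta+\dots+\partial^k f(x)\, \frac{\delta^k}{k!}. \]
   Context: Logical setting: the reasoning is intuitionistic, so neither the law of excluded middle nor the axiom of choice is available (with excluded middle no ring as below exists). The axiom of unique choice is allowed: if for every $a\in A$ there is a unique $b\in B$ with $P(a,b)$, one obtains a function $F\colon A\to B$ such that $P(a,F(a))$ for all $a$. Rings are commutative with unit and $\mathbb{N}$ contains $0$. For a commutative ring $R$ and $k\in\mathbb{N}$, $D_k=\{r\in R : r^{k+1}=0\}$, and $D=D_1=\{r\in R: r^2=0\}$. $R$ is $1$-Kock--Lawvere if it is nontrivial ($0\neq 1$) and for every function $g\colon D\to R$ there is a unique $b\in R$ such that $g(d)=g(0)+bd$ for all $d\in D$. $R$ is Kock--Lawvere if it is nontrivial and for every $k\in\mathbb{N}$ and every function $g\colon D_k\to R$ there are unique $b_0,\dots,b_{k-1}\in R$ such that $g(d)=g(0)+\sum_{i<k} b_i d^{i+1}$ for all $d\in D_k$. (Kock--Lawvere implies $1$-Kock--Lawvere.) Derivative: if $R$ is $1$-Kock--Lawvere and $f\colon R\to R$ is any function, $\partial f\colon R\to R$ is the function sending $x$ to the unique $b\in R$ such that $f(x+d)=f(x)+b\,d$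 for all $d\in D$. $\partial^n$ denotes the $n$-fold iterate, with $\partial^0 f=f$. -}

open import Algebra.Bundles using (CommutativeRing)

module Defs where

open import Algebra.Morphism.Structures using (IsRingHomomorphism)
import Algebra.Properties.Semiring.Exp as Exp
import Algebra.Properties.Semiring.Sum as Sum
open import Data.Fin.Base using (toℕ)
import Data.Fin.Base as Fin
open import Data.Integer.Base using (1ℤ)
open import Data.Nat.Base using (ℕ; zero; suc; _!)
open import Data.Nat.Properties using (_!≢0)
open import Data.Product.Base using (Σ; _,_; proj₁)
open import Data.Product using (∃!)
open import Data.Rational.Base as ℚ using (ℚ)
open import Data.Vec.Functional using (Vector)
open import Data.Vec.Functional.Relation.Binary.Pointwise using (Pointwise)
open import Function.Bundles using (_⟶ₛ_; _⟨$⟩_; Func)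
open import Level using (_⊔_)
open import Relation.Binary.Bundles using (Setoid)
import Relation.Binary.Construct.On as On
open import Relation.Nullary.Negation.Core using (¬_)

1/_! : ℕ → ℚ
1/ n ! = ℚ._/_ 1ℤ (n !) {{n !≢0}}

-- A function between sets, in the informal sense, is a map of setoids.  Since
-- `∃!` carries its witness, unique choice is built in.

module _ {c ℓ} (R : CommutativeRing c ℓ) where

  open CommutativeRing R
  open Exp semiring using (_^_)
  open Sum semiring using (sum-syntax)

  record ℚ-Algebra : Set (c ⊔ ℓ) where
    field
      ι                  : ℚ → Carrier
      isRingHomomorphism : IsRingHomomorphism ℚ.+-*-rawRing rawRing ι

    infixr 7 _•_
    _•_ : ℚ → Carrier → Carrier
    q • r = ι q * r

  D : ℕ → Set (c ⊔ ℓ)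
  D k = Σ Carrier λ r → r ^ suc k ≈ 0#

  D-setoid : ℕ → Setoid (c ⊔ ℓ) ℓ
  D-setoid k = On.setoid setoid (proj₁ {B = λ r → r ^ suc k ≈ 0#})

  0ᴰ : ∀ k → D k
  0ᴰ k = 0# , zeroˡ _

  record IsKockLawvere : Set (c ⊔ ℓ) where
    field
      nontrivial : ¬ (0# ≈ 1#)
      taylor     : ∀ k (g : D-setoid k ⟶ₛ setoid) →
                   ∃! (Pointwise _≈_) λ (b : Vector Carrier k) →
                     ∀ (d : D k) →
                     (g ⟨$⟩ d) ≈ (g ⟨$⟩ 0ᴰ k) + ∑[ i < k ] (b i * proj₁ d ^ suc (toℕ i))

  record Is1KockLawvere : Set (c ⊔ ℓ) where
    field
      nontrivial : ¬ (0# ≈ 1#)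
      affine     : ∀ (g : D-setoid 1 ⟶ₛ setoid) →
                   ∃! _≈_ λ (b : Carrier) →
                     ∀ (d : D 1) → (g ⟨$⟩ d) ≈ (g ⟨$⟩ 0ᴰ 1) + b * proj₁ d

  KL⇒1KL : IsKockLawvere → Is1KockLawvere
  KL⇒1KL kl = record
    { nontrivial = nontrivial
    ; affine     = λ g → let (b , eq , uniq) = taylor 1 g in
        b Fin.zero ,
        (λ d → trans (eq d) (+-congˡ (linear _ (proj₁ d)))) ,
        (λ {b′} eq′ → uniq {λ _ → b′}
          (λ d → trans (eq′ d) (+-congˡ (sym (linear b′ (proj₁ d))))) Fin.zero)
    }
    where
    open IsKockLawvere kl
    linear : ∀ b x → b * x ^ 1 + 0# ≈ b * x
    linear b x = trans (+-identityʳ _) (*-congˡ (*-identityʳ x))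

  module Derivative (kl₁ : Is1KockLawvere) where

    open Is1KockLawvere kl₁

    IsDerivativeAt : setoid ⟶ₛ setoid → Carrier → Carrier → Set (c ⊔ ℓ)
    IsDerivativeAt f x b = ∀ (d : D 1) → (f ⟨$⟩ (x + proj₁ d)) ≈ (f ⟨$⟩ x) + b * proj₁ d

    derivativeAt : ∀ f x → ∃! _≈_ (IsDerivativeAt f x)
    derivativeAt f x = let (b , eq , uniq) = affine g in
      b ,
      (λ d → trans (eq d) (+-congʳ g0≈fx)) ,
      (λ eq′ → uniq (λ d → trans (eq′ d) (+-congʳ (sym g0≈fx))))
      where
      g : D-setoid 1 ⟶ₛ setoid
      g = record
        { to   = λ d → f ⟨$⟩ (x + proj₁ d)
        ; cong = λ d≈d′ → Func.cong f (+-congˡ d≈d′)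
        }
      g0≈fx : (g ⟨$⟩ 0ᴰ 1) ≈ (f ⟨$⟩ x)
      g0≈fx = Func.cong f (+-identityʳ x)

    ∂ : setoid ⟶ₛ setoid → setoid ⟶ₛ setoid
    ∂ f = record
      { to   = λ x → proj₁ (derivativeAt f x)
      ; cong = λ {x} {y} x≈y →
          let (_ , _  , uniq) = derivativeAt f x
              (_ , eq , _)    = derivativeAt f y
          in uniq λ d → trans (Func.cong f (+-congʳ x≈y))
                       (trans (eq d) (+-congʳ (sym (Func.cong f x≈y))))
      }

    ∂^ : ℕ → setoid ⟶ₛ setoid → setoid ⟶ₛ setoid
    ∂^ zero    f = f
    ∂^ (suc n) f = ∂ (∂^ n f)

{-# OPTIONS --safe #-}
-- Induction on k.  For γ n δ = δⁿ/n! and d² = 0 one has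
-- γ (n+1) (d + δ) = γ (n+1) δ + d γ n δ, while f (x + d + δ) is expanded by the
-- induction hypothesis at x + d, where ∂ⁿf (x + d) = ∂ⁿf x + ∂ⁿ⁺¹f x d.  The two
-- expansions differ by a multiple of γ (k+1) δ, which vanishes because a sum of k
-- elements of D lies in D_k.

module Submission where

open import Defs
open import Algebra.Bundles using (CommutativeRing)
open import Algebra.Morphism.Structures using (IsRingHomomorphism)
open import Data.Fin.Base using (toℕ)
import Data.Fin.Base as Fin
open import Data.Integer.Base as ℤ using (+_; 1ℤ)
import Data.Integer.Properties as ℤ
open import Data.Nat.Base as ℕ using (ℕ; zero; suc; _!)
import Data.Nat.Properties as ℕ
open import Data.Product.Base using (_,_; proj₁; proj₂)
open import Data.Rational.Base as ℚ using (ℚ)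
import Data.Rational.Properties as ℚ
open import Data.Rational.Unnormalised.Base as ℚᵘ using (mkℚᵘ; *≡*)
import Data.Rational.Unnormalised.Properties as ℚᵘ
open import Data.Vec.Functional using (Vector)
open import Function.Base using (_∘_)
open import Function.Bundles using (_⟶ₛ_; _⟨$⟩_; Func)
open import Relation.Binary.PropositionalEquality as ≡ using (_≡_)
import Algebra.Properties.CommutativeMonoid.Sum as CommutativeMonoidSum
import Algebra.Properties.Semiring.Exp as Exp
import Algebra.Properties.Semiring.Sum as Sum
import Algebra.Solver.Ring.NaturalCoefficients.Default as NaturalCoefficients
import Relation.Binary.Reasoning.Setoid as SetoidReasoning

-- Natural coefficients are formed in `ℚ`, not as multiples of `1#`, so that `ι` can cancel them
-- against inverse factorials.
fromℕ : ℕ → ℚ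
fromℕ n = + n ℚ./ 1

fromℕ-suc : ∀ n → fromℕ (suc n) ≡ ℚ.1ℚ ℚ.+ fromℕ n
fromℕ-suc n = ℚ.toℚᵘ-injective (begin
  ℚ.toℚᵘ (fromℕ (suc n))                ≈⟨ ℚ.toℚᵘ-fromℚᵘ (mkℚᵘ (+ suc n) 0) ⟩
  -- Both denominators are 1, so after cross-multiplying only the factor 1 that addition of
  -- fractions puts on `+ n` is left to remove.
  mkℚᵘ (+ suc n) 0                      ≈⟨ *≡* (≡.cong (λ i → (1ℤ ℤ.+ i) ℤ.* 1ℤ) (≡.sym (ℤ.*-identityʳ (+ n)))) ⟩
  ℚᵘ.1ℚᵘ ℚᵘ.+ mkℚᵘ (+ n) 0              ≈⟨ ℚᵘ.+-congʳ ℚᵘ.1ℚᵘ (ℚ.toℚᵘ-fromℚᵘ (mkℚᵘ (+ n) 0)) ⟨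
  ℚᵘ.1ℚᵘ ℚᵘ.+ ℚ.toℚᵘ (fromℕ n)          ≈⟨ ℚ.toℚᵘ-homo-+ ℚ.1ℚ (fromℕ n) ⟨
  ℚ.toℚᵘ (ℚ.1ℚ ℚ.+ fromℕ n)             ∎)
  where open SetoidReasoning ℚᵘ.≃-setoid

-- Reducing to lowest terms blocks computation with symbolic `m` and `d`; between unnormalised
-- fractions the claim is a cross-multiplication.
m*1/[m*d]≡1/d : ∀ m d .{{_ : ℕ.NonZero m}} .{{_ : ℕ.NonZero d}} .{{_ : ℕ.NonZero (m ℕ.* d)}} →
                fromℕ m ℚ.* (1ℤ ℚ./ (m ℕ.* d)) ≡ 1ℤ ℚ./ d
m*1/[m*d]≡1/d m@(suc _) d@(suc d-1) = ℚ.toℚᵘ-injective (begin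
  ℚ.toℚᵘ (fromℕ m ℚ.* (1ℤ ℚ./ (m ℕ.* d)))             ≈⟨ ℚ.toℚᵘ-homo-* (fromℕ m) (1ℤ ℚ./ (m ℕ.* d)) ⟩
  ℚ.toℚᵘ (fromℕ m) ℚᵘ.* ℚ.toℚᵘ (1ℤ ℚ./ (m ℕ.* d))     ≈⟨ ℚᵘ.*-cong (ℚ.toℚᵘ-fromℚᵘ (mkℚᵘ (+ m) 0)) (ℚ.toℚᵘ-fromℚᵘ (mkℚᵘ 1ℤ _)) ⟩
  mkℚᵘ (+ m) 0 ℚᵘ.* (1ℤ ℚᵘ./ (m ℕ.* d))               ≈⟨ *≡* (≡.cong +_ cross) ⟩
  mkℚᵘ 1ℤ d-1                                         ≈⟨ ℚ.toℚᵘ-fromℚᵘ (mkℚᵘ 1ℤ d-1) ⟨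
  ℚ.toℚᵘ (1ℤ ℚ./ d)                                   ∎)
  where
  open SetoidReasoning ℚᵘ.≃-setoid
  cross : m ℕ.* 1 ℕ.* d ≡ 1 ℕ.* (1 ℕ.* (m ℕ.* d))
  cross = ≡.trans (≡.cong (ℕ._* d) (ℕ.*-identityʳ m))
                  (≡.sym (≡.trans (ℕ.*-identityˡ _) (ℕ.*-identityˡ _)))

module _ {c ℓ} (R : CommutativeRing c ℓ) where

  open CommutativeRing R
  open Exp semiring using (_^_)
  open Sum semiring using (sum-syntax; sum-cong-≋)
  open CommutativeMonoidSum +-commutativeMonoid using (∑-distrib-+)
  open NaturalCoefficients commutativeSemiring using (solve; _:=_; _:+_; _:*_; con)
  open SetoidReasoning setoid

  -- Finite sums unfold at their first index, whereas the term that vanishes in the Taylor expansion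
  -- is the last one.
  ∑-snoc : ∀ n (a : ℕ → Carrier) → ∑[ i < suc n ] a (toℕ i) ≈ ∑[ i < n ] a (toℕ i) + a n
  ∑-snoc zero    a = +-comm (a 0) 0#
  ∑-snoc (suc n) a = begin
    a 0 + ∑[ i < suc n ] a (suc (toℕ i))        ≈⟨ +-congˡ (∑-snoc n (a ∘ suc)) ⟩
    a 0 + (∑[ i < n ] a (suc (toℕ i)) + a (suc n)) ≈⟨ +-assoc _ _ _ ⟨
    a 0 + ∑[ i < n ] a (suc (toℕ i)) + a (suc n) ∎

  x²≈0 : (d : D R 1) → proj₁ d * proj₁ d ≈ 0#
  x²≈0 (d , d²≈0) = trans (*-congˡ (sym (*-identityʳ d))) d²≈0

  module _ (alg : ℚ-Algebra R) where

    open ℚ-Algebra alg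
    open IsRingHomomorphism isRingHomomorphism using (⟦⟧-cong; +-homo; *-homo; 1#-homo)

    ι-fromℕ-suc : ∀ n → ι (fromℕ (suc n)) ≈ 1# + ι (fromℕ n)
    ι-fromℕ-suc n = begin
      ι (fromℕ (suc n))           ≈⟨ ⟦⟧-cong (fromℕ-suc n) ⟩
      ι (ℚ.1ℚ ℚ.+ fromℕ n)        ≈⟨ +-homo ℚ.1ℚ (fromℕ n) ⟩
      ι ℚ.1ℚ + ι (fromℕ n)        ≈⟨ +-congʳ 1#-homo ⟩
      1# + ι (fromℕ n)            ∎

    -- The binomial expansion stops after the linear term because d² = 0. Starting from exponent
    -- `suc n` avoids a predecessor in the exponent of `y`.
    ^-suc-+ : ∀ (d : D R 1) y n →
              (proj₁ d + y) ^ suc n ≈ y ^ suc n + proj₁ d * (fromℕ (suc n) • y ^ n)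
    ^-suc-+ (d , _) y zero = begin
      (d + y) * 1#                     ≈⟨ solve 2 (λ d y → (d :+ y) :* con 1 := y :* con 1 :+ d :* (con 1 :* con 1)) refl d y ⟩
      -- `fromℕ 1` computes to `ℚ.1ℚ`.
      y * 1# + d * (1# * 1#)           ≈⟨ +-congˡ (*-congˡ (*-congʳ 1#-homo)) ⟨
      y * 1# + d * (ι ℚ.1ℚ * 1#)       ∎
    ^-suc-+ d′@(d , _) y (suc n) = begin
      (d + y) * (d + y) ^ suc n
        ≈⟨ *-congˡ (^-suc-+ d′ y n) ⟩
      (d + y) * (y * z + d * (p * z))
        -- The solver knows only the semiring laws, so the multiple of `d * d` is isolated here and
        -- removed afterwards.
        ≈⟨ solve 4 (λ d y p z → (d :+ y) :* (y :* z :+ d :* (p :* z))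
                     := y :* (y :* z) :+ d :* ((con 1 :+ p) :* (y :* z)) :+ d :* d :* (p :* z)) refl d y p z ⟩
      y * (y * z) + d * ((1# + p) * (y * z)) + d * d * (p * z)
        ≈⟨ +-congˡ (trans (*-congʳ (x²≈0 d′)) (zeroˡ _)) ⟩
      y * (y * z) + d * ((1# + p) * (y * z)) + 0#
        ≈⟨ +-identityʳ _ ⟩
      y * (y * z) + d * ((1# + p) * (y * z))
        ≈⟨ +-congˡ (*-congˡ (*-congʳ (ι-fromℕ-suc (suc n)))) ⟨
      y * (y * z) + d * (ι (fromℕ (suc (suc n))) * (y * z)) ∎
      where
      p = ι (fromℕ (suc n))
      z = y ^ n

    -- D_1 + ⋯ + D_1 (k summands) ⊆ D_k
    ∑-^-suc≈0 : ∀ k (d : Vector (D R 1) k) → (∑[ i < k ] proj₁ (d i)) ^ suc k ≈ 0#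
    ∑-^-suc≈0 zero    d = zeroˡ 1#
    ∑-^-suc≈0 (suc k) d = begin
      (proj₁ d₀ + δ) ^ suc (suc k)                             ≈⟨ ^-suc-+ d₀ δ (suc k) ⟩
      δ * δ ^ suc k + proj₁ d₀ * (fromℕ (suc (suc k)) • δ ^ suc k)
        ≈⟨ +-cong (*-congˡ δ^≈0) (*-congˡ (*-congˡ δ^≈0)) ⟩
      δ * 0# + proj₁ d₀ * (fromℕ (suc (suc k)) • 0#)
        ≈⟨ solve 3 (λ x y z → x :* con 0 :+ y :* (z :* con 0) := con 0) refl _ _ _ ⟩
      0#                                                       ∎
      where
      d₀ = d Fin.zero
      δ = ∑[ i < k ] proj₁ (d (Fin.suc i))
      δ^≈0 = ∑-^-suc≈0 k (d ∘ Fin.suc)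

    γ : ℕ → Carrier → Carrier
    γ n y = 1/ n ! • y ^ n

    -- This is `^-suc-+` divided by (n+1)!: the coefficient n+1 cancels and leaves 1/n!.
    γ-suc-+ : ∀ (d : D R 1) y n → γ (suc n) (proj₁ d + y) ≈ γ (suc n) y + proj₁ d * γ n y
    γ-suc-+ d′@(d , _) y n = begin
      q * (d + y) ^ suc n
        ≈⟨ *-congˡ (^-suc-+ d′ y n) ⟩
      q * (y ^ suc n + d * (p * y ^ n))
        ≈⟨ solve 5 (λ q u d p z → q :* (u :+ d :* (p :* z)) := q :* u :+ d :* (p :* q :* z)) refl q (y ^ suc n) d p (y ^ n) ⟩
      q * y ^ suc n + d * (p * q * y ^ n)
        ≈⟨ +-congˡ (*-congˡ (*-congʳ pq≈1/n!)) ⟩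
      q * y ^ suc n + d * (ι (1/ n !) * y ^ n) ∎
      where
      p = ι (fromℕ (suc n))
      q = ι (1/ suc n !)
      pq≈1/n! : p * q ≈ ι (1/ n !)
      -- The cancellation lemma applies because `suc n !` unfolds to `suc n ℕ.* n !`.
      pq≈1/n! = trans (sym (*-homo _ _))
        (⟦⟧-cong (m*1/[m*d]≡1/d (suc n) (n !) {{_}} {{n ℕ.!≢0}} {{suc n ℕ.!≢0}}))

    -- The algebra of the induction step, with `a n` standing for ∂ⁿf(x). Each summand on the left
    -- splits as `s n + t n`, and `t n` is then regrouped with `s (suc n)`.
    ∑-γ-+ : ∀ k (a : ℕ → Carrier) (d : D R 1) y → y ^ suc k ≈ 0# →
            ∑[ n < suc k ] ((a (toℕ n) + a (suc (toℕ n)) * proj₁ d) * γ (toℕ n) y) ≈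
            ∑[ n < suc (suc k) ] (a (toℕ n) * γ (toℕ n) (proj₁ d + y))
    ∑-γ-+ k a d′@(d , _) y y^≈0 = begin
      ∑[ n < suc k ] ((a (toℕ n) + a (suc (toℕ n)) * d) * γ (toℕ n) y)
        ≈⟨ sum-cong-≋ {suc k} (λ n → solve 4 (λ a b d g → (a :+ b :* d) :* g := a :* g :+ b :* (d :* g)) refl
             (a (toℕ n)) (a (suc (toℕ n))) d (γ (toℕ n) y)) ⟩
      ∑[ n < suc k ] (s (toℕ n) + t (toℕ n))
        ≈⟨ ∑-distrib-+ {suc k} (s ∘ toℕ) (t ∘ toℕ) ⟩
      ∑[ n < suc k ] s (toℕ n) + T
        -- Inserting the zero term `s (suc k)` lengthens the sum of `s`, so that removing `s 0` in
        -- front leaves as many terms as `T` has.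
        ≈⟨ +-congʳ (+-identityʳ _) ⟨
      ∑[ n < suc k ] s (toℕ n) + 0# + T
        ≈⟨ +-congʳ (+-congˡ s≈0) ⟨
      ∑[ n < suc k ] s (toℕ n) + s (suc k) + T
        ≈⟨ +-congʳ (∑-snoc (suc k) s) ⟨
      s 0 + ∑[ n < suc k ] s (suc (toℕ n)) + T
        ≈⟨ +-assoc _ _ _ ⟩
      s 0 + (∑[ n < suc k ] s (suc (toℕ n)) + T)
        ≈⟨ +-congˡ (∑-distrib-+ {suc k} (s ∘ suc ∘ toℕ) (t ∘ toℕ)) ⟨
      s 0 + ∑[ n < suc k ] (s (suc (toℕ n)) + t (toℕ n))
        -- `s (suc n)` and `t n` share the factor `a (suc n)`. The term `s 0` already has its final
        -- form, since `γ 0` is constant by computation.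
        ≈⟨ +-congˡ (sum-cong-≋ {suc k} λ n → trans (sym (distribˡ _ _ _)) (*-congˡ {a (suc (toℕ n))} (sym (γ-suc-+ d′ y (toℕ n))))) ⟩
      s 0 + ∑[ n < suc k ] (a (suc (toℕ n)) * γ (suc (toℕ n)) (d + y)) ∎
      where
      s t : ℕ → Carrier
      s n = a n * γ n y
      t n = a (suc n) * (d * γ n y)
      T = ∑[ n < suc k ] t (toℕ n)
      s≈0 : s (suc k) ≈ 0#
      s≈0 = trans (*-congˡ (trans (*-congˡ y^≈0) (zeroʳ _))) (zeroʳ _)

    module _ (kl₁ : Is1KockLawvere R) where

      open Derivative R kl₁

      taylor-∑D : ∀ k (d : Vector (D R 1) k) (f : setoid ⟶ₛ setoid) x →
                  let δ = ∑[ i < k ] proj₁ (d i) in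
                  f ⟨$⟩ (x + δ) ≈ ∑[ n < suc k ] ((∂^ (toℕ n) f ⟨$⟩ x) * γ (toℕ n) δ)
      taylor-∑D zero d f x = begin
        f ⟨$⟩ (x + 0#)                      ≈⟨ Func.cong f (+-identityʳ x) ⟩
        f ⟨$⟩ x                             ≈⟨ solve 1 (λ y → y := y :* (con 1 :* con 1) :+ con 0) refl _ ⟩
        -- `1/ 0 !` computes to `ℚ.1ℚ`.
        (f ⟨$⟩ x) * (1# * 1#) + 0#          ≈⟨ +-congʳ (*-congˡ (*-congʳ 1#-homo)) ⟨
        (f ⟨$⟩ x) * (ι ℚ.1ℚ * 1#) + 0#      ∎
      taylor-∑D (suc k) d f x = begin
        f ⟨$⟩ (x + (proj₁ d₀ + δ))
          ≈⟨ Func.cong f (+-assoc _ _ _) ⟨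
        f ⟨$⟩ (x + proj₁ d₀ + δ)
          ≈⟨ taylor-∑D k (d ∘ Fin.suc) f (x + proj₁ d₀) ⟩
        ∑[ n < suc k ] ((∂^ (toℕ n) f ⟨$⟩ (x + proj₁ d₀)) * γ (toℕ n) δ)
          -- `∂^ (suc n) f` takes at `x` the witness of `derivativeAt (∂^ n f) x`, so the defining
          -- property of that witness, applied to `d₀`, expands each coefficient.
          ≈⟨ sum-cong-≋ {suc k} (λ n → *-congʳ {γ (toℕ n) δ} (proj₁ (proj₂ (derivativeAt (∂^ (toℕ n) f) x)) d₀)) ⟩
        ∑[ n < suc k ] (((∂^ (toℕ n) f ⟨$⟩ x) + (∂^ (suc (toℕ n)) f ⟨$⟩ x) * proj₁ d₀) * γ (toℕ n) δ)
          ≈⟨ ∑-γ-+ k (λ n → ∂^ n f ⟨$⟩ x) d₀ δ (∑-^-suc≈0 k (d ∘ Fin.suc)) ⟩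
        ∑[ n < suc (suc k) ] ((∂^ (toℕ n) f ⟨$⟩ x) * γ (toℕ n) (proj₁ d₀ + δ)) ∎
        where
        d₀ = d Fin.zero
        δ = ∑[ i < k ] proj₁ (d (Fin.suc i))

proposition4p2p2 :
  ∀ {c ℓ} (R : CommutativeRing c ℓ) (kl : IsKockLawvere R) (alg : ℚ-Algebra R) →
  let open CommutativeRing R
      open Exp semiring using (_^_)
      open Sum semiring using (sum-syntax)
      open ℚ-Algebra alg using (_•_)
      open Derivative R (KL⇒1KL R kl) using (∂^)
  in
  (k : ℕ) (d : Vector (D R 1) k) →
  let δ = ∑[ i < k ] proj₁ (d i) in
  (f : setoid ⟶ₛ setoid) (x : Carrier) →
  f ⟨$⟩ (x + δ) ≈ ∑[ n < suc k ] ((∂^ (toℕ n) f ⟨$⟩ x) * (1/ toℕ n ! • δ ^ toℕ n))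
proposition4p2p2 R kl alg = taylor-∑D R alg (KL⇒1KL R kl)
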